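{- Let $m$ be an even positive integer and let $D_{2m}=\langle u,v : u^m=e=v^2,\ vu=u^{m-1}v\rangle$. If $S\subseteq D_{2m}\setminus\{e\}$ with $|S|=2m-2$, then $D_{2m}$ has an $S$-sequencing.
   Context: For a group $G$ with identity $e$ and a set $S\subseteq G\setminus\{e\}$ with $|S|=k$, an $S$-sequencing of $G$ is an ordering $(g_1,\dots,g_k)$ of the elements of $S$ (each used exactly once) such that the partial products $h_0=e$, $h_i=g_1g_2\cdots g_i$ ($1\le i\le k$) are pairwise distinct. -}

module Defs where

open import Algebra.Bundles using (Group)
open import Data.List.Base using (List; length)
import Data.List.Membership.Setoid as ListMembership
import Data.List.Relation.Unary.Unique.Setoid as UniqueSetoid
open import Data.List.Scans.Base using (scanl)
open import Data.Nat.Base using (ℕ; zero; suc; _∸_)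
open import Data.Product.Base using (_×_; _,_; ∃-syntax)
open import Function.Bundles using (_⇔_)
open import Level using (Level; 0ℓ)
open import Relation.Binary.Core using (Rel)
open import Relation.Binary.PropositionalEquality.Core using (_≡_)
open import Relation.Unary using (Pred; _∈_)

-- Groups given by generators and relations: formal group expressions in the
-- generators X, modulo the least congruence that contains R and satisfies
-- the group axioms.

infixl 7 _∙_
infix  8 _⁻¹
infixr 8 _^_

data Expr (X : Set) : Set where
  gen : X → Expr X
  ε   : Expr X
  _∙_ : Expr X → Expr X → Expr X
  _⁻¹ : Expr X → Expr X

_^_ : {X : Set} → Expr X → ℕ → Expr X
x ^ zero  = ε
x ^ suc n = x ∙ x ^ n

data Congruence {X : Set} (R : Rel (Expr X) 0ℓ) : Rel (Expr X) 0ℓ where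
  relation  : ∀ {x y} → R x y → Congruence R x y
  refl      : ∀ {x} → Congruence R x x
  sym       : ∀ {x y} → Congruence R x y → Congruence R y x
  trans     : ∀ {x y z} → Congruence R x y → Congruence R y z → Congruence R x z
  ∙-cong    : ∀ {x x′ y y′} → Congruence R x x′ → Congruence R y y′ →
              Congruence R (x ∙ y) (x′ ∙ y′)
  ⁻¹-cong   : ∀ {x y} → Congruence R x y → Congruence R (x ⁻¹) (y ⁻¹)
  assoc     : ∀ x y z → Congruence R ((x ∙ y) ∙ z) (x ∙ (y ∙ z))
  identityˡ : ∀ x → Congruence R (ε ∙ x) x
  identityʳ : ∀ x → Congruence R (x ∙ ε) x
  inverseˡ  : ∀ x → Congruence R (x ⁻¹ ∙ x) ε
  inverseʳ  : ∀ x → Congruence R (x ∙ x ⁻¹) ε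

⟨_∣_⟩ : (X : Set) → Rel (Expr X) 0ℓ → Group 0ℓ 0ℓ
⟨ X ∣ R ⟩ = record
  { Carrier = Expr X
  ; _≈_     = Congruence R
  ; _∙_     = _∙_
  ; ε       = ε
  ; _⁻¹     = _⁻¹
  ; isGroup = record
    { isMonoid = record
      { isSemigroup = record
        { isMagma = record
          { isEquivalence = record { refl = refl ; sym = sym ; trans = trans }
          ; ∙-cong        = ∙-cong
          }
        ; assoc = assoc
        }
      ; identity = identityˡ , identityʳ
      }
    ; inverse = inverseˡ , inverseʳ
    ; ⁻¹-cong = ⁻¹-cong
    }
  }

data Generator : Set where
  u v : Generator

data DihedralRelation (m : ℕ) : Rel (Expr Generator) 0ℓ where
  uᵐ≈e     : DihedralRelation m (gen u ^ m) ε
  v²≈e     : DihedralRelation m (gen v ^ 2) ε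
  vu≈uᵐ⁻¹v : DihedralRelation m (gen v ∙ gen u) (gen u ^ (m ∸ 1) ∙ gen v)

-- The group usually written D₂ₘ: the parameter is m, half the order.
Dihedral : ℕ → Group 0ℓ 0ℓ
Dihedral m = ⟨ Generator ∣ DihedralRelation m ⟩

module _ {c ℓ : Level} (G : Group c ℓ) where

  private
    module G = Group G
  open ListMembership G.setoid using () renaming (_∈_ to _∈ₗ_)
  open UniqueSetoid G.setoid using (Unique)

  -- xs lists the elements of S, each exactly once up to the equality of G.
  -- Since list membership is taken up to that equality, this also forces
  -- S to respect it, so S is a subset of the group rather than merely of
  -- its representatives.
  IsOrderingOf : {s : Level} → List G.Carrier → Pred G.Carrier s → Set _
  IsOrderingOf xs S = Unique xs × (∀ x → x ∈ S ⇔ x ∈ₗ xs)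

  HasCardinality : {s : Level} → Pred G.Carrier s → ℕ → Set _
  HasCardinality S k = ∃[ xs ] IsOrderingOf xs S × length xs ≡ k

  -- [h₀, h₁, …, hₖ] with h₀ = e and hᵢ = g₁ g₂ ⋯ gᵢ.
  partialProducts : List G.Carrier → List G.Carrier
  partialProducts = scanl G._∙_ G.ε

  HasSequencing : {s : Level} → Pred G.Carrier s → Set _
  HasSequencing S = ∃[ gs ] IsOrderingOf gs S × Unique (partialProducts gs)

{-# OPTIONS --safe #-}

-- D₂ₘ is R-sequenceable for even m: some closed walk in its Cayley graph passes
-- through 2m - 1 distinct vertices along edges labelled by the 2m - 1 nontrivial
-- elements. Deleting the edge labelled by the one nontrivial element missing from S
-- and translating the start of the remaining path to e gives the partial products.
--
-- For m = 2k, n = k - 1 and t = ⌈n/2⌉, the walk starts in e and alternates between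
-- rotations u^0, u^-1, …, u^-n and reflections u^j v for j = 0, …, t - 1, t + 1, …, k.
-- Its labels are the reflections u^i v in increasing order, where i = 2t is skipped
-- because the reflection u^t v is. Zigzagging through u^k v, …, u^(2k - 1) v it uses
-- half of the rotations as labels; a step labelled u^(2t) v and a zigzag through
-- u^1, …, u^k back to e provide the rest.

module Submission where

open import Defs using (HasCardinality; HasSequencing; partialProducts; Expr; Generator; Dihedral)
open import Algebra.Bundles using (Group)
import Algebra.Properties.Group as Groupₚ
import Data.Integer.Base as ℤ
open import Data.Integer.Base using (ℤ; 0ℤ; 1ℤ; -1ℤ)
import Data.Integer.Properties as ℤₚ
import Data.Integer.Tactic.RingSolver as ℤSolver
open import Data.List.Base using (List; []; _∷_; [_]; _++_; length; map; applyUpTo)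
open import Data.List.Properties using (length-++; length-applyUpTo)
import Data.List.Membership.Setoid as ListMembership
import Data.List.Membership.Setoid.Properties as ∈ₚ
import Data.List.Relation.Binary.Equality.Setoid as ListEquality
import Data.List.Relation.Binary.Permutation.Setoid as Permutation
import Data.List.Relation.Binary.Permutation.Setoid.Properties as Permutationₚ
import Data.List.Relation.Binary.Subset.Setoid as Subset
open import Data.List.Relation.Unary.Any using (here; there)
import Data.List.Relation.Unary.Unique.Setoid as UniqueSetoid
import Data.List.Relation.Unary.Unique.Setoid.Properties as Uniqueₚ
open import Data.List.Scans.Base using (scanl)
open import Data.Nat.Base using (ℕ; zero; suc; _+_; _*_; _∸_; _/_; _%_; _<_; s≤s; z<s; s<s;
  s<s⁻¹; ⌊_/2⌋; ⌈_/2⌉; NonZero; >-nonZero)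
open import Data.Nat.Divisibility using (_∣_; divides; >⇒∤)
open import Data.Nat.DivMod using (m≡m%n+[m/n]*n; m%n<n)
open import Data.Nat.Properties using (+-assoc; +-comm; +-suc; +-identityʳ; +-cancelˡ-≡;
  *-suc; m∸n≤m; m∸n+n≡m; m<n⇒0<n∸m; ∸-monoʳ-<; ≤-<-trans; <⇒≤; n<1+n; m<1+n⇒m<n∨m≡n;
  ⌊n/2⌋+⌈n/2⌉≡n)
open import Data.Nat.Tactic.RingSolver using (solve-∀)
open import Data.Product.Base using (_×_; _,_; ∃-syntax; proj₁; proj₂)
open import Data.Sum.Base using (_⊎_; inj₁; inj₂)
open import Function.Bundles using (module Equivalence; mk⇔)
open import Level using (Level; _⊔_)
open import Relation.Binary.Bundles using (Setoid)
open import Relation.Binary.PropositionalEquality as ≡ using (_≡_; cong; cong₂)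
import Relation.Binary.Reasoning.Setoid as SetoidReasoning
open import Relation.Nullary using (¬_; contradiction)
open import Relation.Unary using (Pred; _∉_)

-- Counting with lists up to permutation

module Pigeonhole {c ℓ : Level} (A : Setoid c ℓ) where
  open Setoid A
  open ListMembership A using (_∈_)
  open UniqueSetoid A using (Unique)
  open ListEquality A using (_∷_; ≋-refl)
  open Permutation A using
    (_↭_; ↭-refl; ↭-trans; ↭-prep; ↭-swap; ↭-reflexive-≋)
  open Permutationₚ A using
    (∈-resp-↭; xs↭ys⇒|xs|≡|ys|; ++⁺ˡ; ↭-shift; ++-comm; ++-identityʳ)
  open Subset A using (_⊆_)

  ∈⇒↭∷ : ∀ {x xs} → x ∈ xs → ∃[ ys ] xs ↭ x ∷ ys
  ∈⇒↭∷ (here x≈y) = _ , ↭-reflexive-≋ (sym x≈y ∷ ≋-refl)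
  ∈⇒↭∷ (there {y} x∈xs) with ys , p ← ∈⇒↭∷ x∈xs =
    y ∷ ys , ↭-trans (↭-prep y p) (↭-swap y _ ↭-refl)

  -- Induction on `xs`: once the tail has been moved to the front of `ys`, the head `x` must lie in
  -- the remainder, since uniqueness keeps it out of the tail.
  unique-⊆⇒↭++ : ∀ {xs ys} → Unique xs → xs ⊆ ys → ∃[ zs ] ys ↭ xs ++ zs
  unique-⊆⇒↭++ {[]} _ _ = _ , ↭-refl
  unique-⊆⇒↭++ {x ∷ xs} x∷xs! ⊆ys
    with zs , p ← unique-⊆⇒↭++ (UniqueSetoid.tail A x∷xs!) (λ z∈xs → ⊆ys (there z∈xs))
    with ∈ₚ.∈-++⁻ A xs (∈-resp-↭ p (⊆ys (here refl)))
  ... | inj₁ x∈xs = contradiction x∈xs (Uniqueₚ.Unique[x∷xs]⇒x∉xs A x∷xs!)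
  ... | inj₂ x∈zs with ws , q ← ∈⇒↭∷ x∈zs =
    ws , ↭-trans p (↭-trans (++⁺ˡ xs q) (↭-shift xs ws))

  -- Equal lengths leave no room for a remainder. As `ys` is not assumed duplicate-free, this also
  -- serves to prove that it is.
  unique-⊆⇒↭ : ∀ {xs ys} → Unique xs → xs ⊆ ys → length ys ≡ length xs → ys ↭ xs
  unique-⊆⇒↭ {xs} {ys} xs! xs⊆ys |ys|≡|xs| with unique-⊆⇒↭++ xs! xs⊆ys
  ... | [] , p = ↭-trans p (++-identityʳ xs)
  ... | z ∷ zs , p with () ← +-cancelˡ-≡ (length xs) (suc (length zs)) 0 (≡.trans
    (≡.sym (≡.trans (xs↭ys⇒|xs|≡|ys| p) (length-++ xs)))
    (≡.trans |ys|≡|xs| (≡.sym (+-identityʳ _))))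

  -- Here the remainder has length one; it will be the label to delete from the closed walk.
  unique-⊆⇒↭∷ : ∀ {xs ys} → Unique xs → xs ⊆ ys → length ys ≡ suc (length xs) →
                ∃[ x ] ys ↭ x ∷ xs
  unique-⊆⇒↭∷ {xs} {ys} xs! xs⊆ys |ys| with zs , p ← unique-⊆⇒↭++ xs! xs⊆ys
    with zs | p | +-cancelˡ-≡ (length xs) (length zs) 1 (≡.trans
      (≡.sym (≡.trans (xs↭ys⇒|xs|≡|ys| p) (length-++ xs)))
      (≡.trans |ys| (+-comm 1 (length xs))))
  ... | x ∷ [] | p | _ = x , ↭-trans p (++-comm xs [ x ])

-- Walks in Cayley graphs and sequencings

module Walks {c ℓ : Level} (G : Group c ℓ) where
  open Group G
  open ListMembership setoid using (_∈_)
  open UniqueSetoid setoid using (Unique)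
  open ListEquality setoid using (_≋_; []; _∷_; ≋-refl)
  open Permutation setoid using (_↭_; ↭-sym; ↭-trans; ↭-prep; ↭-reflexive-≋)
  open Permutationₚ setoid using
    (Unique-resp-↭; ∈-resp-↭; drop-∷; ↭-shift; ++-comm; ++⁺ˡ)
  open Pigeonhole setoid

  -- Walk a gs vs b: right multiplication by the successive elements of gs leads
  -- from a to b; vs lists the vertices on the way, a included and b excluded.
  data Walk : Carrier → List Carrier → List Carrier → Carrier → Set (c ⊔ ℓ) where
    stay : ∀ {a b} → a ≈ b → Walk a [] [] b
    step : ∀ {a a′ b d g gs vs} → a ≈ a′ → a′ ∙ g ≈ b → Walk b gs vs d →
           Walk a (g ∷ gs) (a′ ∷ vs) d

  edge : ∀ {a b} g → a ∙ g ≈ b → Walk a [ g ] [ a ] b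
  edge g a∙g≈b = step refl a∙g≈b (stay refl)

  walk-respˡ : ∀ {a b d gs vs} → a ≈ b → Walk b gs vs d → Walk a gs vs d
  walk-respˡ a≈b (stay b≈d)      = stay (trans a≈b b≈d)
  walk-respˡ a≈b (step b≈b′ e w) = step (trans a≈b b≈b′) e w

  infixr 5 _++ʷ_
  _++ʷ_ : ∀ {a b d gs hs vs ws} → Walk a gs vs b → Walk b hs ws d →
          Walk a (gs ++ hs) (vs ++ ws) d
  stay a≈b      ++ʷ w′ = walk-respˡ a≈b w′
  step a≈a′ e w ++ʷ w′ = step a≈a′ e (w ++ʷ w′)

  length-visits : ∀ {a b gs vs} → Walk a gs vs b → length vs ≡ length gs
  length-visits (stay _)     = ≡.refl
  length-visits (step _ _ w) = cong suc (length-visits w)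

  -- Left multiplication commutes with the right multiplications that make up the steps, so it is an
  -- automorphism of the Cayley graph preserving labels.
  translate : ∀ {a b gs vs} x → Walk a gs vs b → Walk (x ∙ a) gs (map (x ∙_) vs) (x ∙ b)
  translate x (stay a≈b)      = stay (∙-congˡ a≈b)
  translate x (step a≈a′ e w) =
    step (∙-congˡ a≈a′) (trans (assoc x _ _) (∙-congˡ e)) (translate x w)

  -- The start `a′` varies in the induction because the accumulated product agrees with the recorded
  -- vertex only up to `_≈_`.
  scanl-walk : ∀ {a b gs vs} → Walk a gs vs b → ∀ {a′} → a′ ≈ a →
               scanl _∙_ a′ gs ≋ vs ++ [ b ]
  scanl-walk (stay a≈b)      a′≈a = trans a′≈a a≈b ∷ []
  scanl-walk (step a≈a″ e w) a′≈a =
    trans a′≈a a≈a″ ∷ scanl-walk w (trans (∙-congʳ (trans a′≈a a≈a″)) e)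

  -- Translation by `a ⁻¹` moves the start to `ε` and is injective, so distinct vertices become
  -- distinct partial products.
  unique-partialProducts : ∀ {a b gs vs} → Walk a gs vs b → Unique (b ∷ vs) →
                           Unique (partialProducts G gs)
  unique-partialProducts {a} {b} {gs} {vs} w b∷vs! =
    Unique-resp-↭ (↭-sym (↭-trans (↭-reflexive-≋ (scanl-walk (translate (a ⁻¹) w)
                      (sym (inverseˡ a))))
                    (++-comm (map (a ⁻¹ ∙_) vs) [ a ⁻¹ ∙ b ])))
      (Uniqueₚ.map⁺ setoid setoid (∙-cancelˡ (a ⁻¹) _ _) b∷vs!)
    where open Groupₚ G using (∙-cancelˡ)

  -- A walk cut at an edge labelled `g`, which runs from `tail` to `head`. Permutations suffice for
  -- the last two fields, as only the collections of labels and vertices matter later.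
  record Split (a : Carrier) (gs vs : List Carrier) (b g : Carrier) : Set (c ⊔ ℓ) where
    field
      {tail head}       : Carrier
      {gs₁ gs₂ vs₁ vs₂} : List Carrier
      before            : Walk a gs₁ vs₁ tail
      after             : Walk head gs₂ vs₂ b
      labels            : gs ↭ gs₁ ++ [ g ] ++ gs₂
      visits            : vs ↭ vs₁ ++ [ tail ] ++ vs₂

  split : ∀ {a b gs vs g} → Walk a gs vs b → g ∈ gs → Split a gs vs b g
  split (step a≈a′ e w) (here g≈h) = record
    { before = stay refl
    ; after  = w
    ; labels = ↭-reflexive-≋ (sym g≈h ∷ ≋-refl)
    ; visits = ↭-reflexive-≋ (sym a≈a′ ∷ ≋-refl)
    }
  split (step a≈a′ e w) (there g∈gs) = record
    { before = step a≈a′ e before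
    ; after  = after
    ; labels = ↭-prep _ labels
    ; visits = ↭-prep _ visits
    }
    where open Split (split w g∈gs)

  -- The `suc k` labels include the `k` elements of `S`, hence are these and one more, `x`. Cutting
  -- the closed walk at an edge labelled `x` leaves a path with exactly the elements of `S` as
  -- labels.
  closedWalk⇒sequencing :
    ∀ {gs vs k s} → Walk ε gs vs ε → Unique vs → length gs ≡ suc k →
    (∀ x → ¬ x ≈ ε → x ∈ gs) →
    (S : Pred Carrier s) → ε ∉ S → HasCardinality G S k → HasSequencing G S
  closedWalk⇒sequencing {gs} w vs! |gs| covers S ε∉S (xs , (xs! , S⇔xs) , |xs|)
    with x , p ← unique-⊆⇒↭∷ xs! (λ {y} y∈xs → covers y (λ y≈ε → ε∉S (Equivalence.from (S⇔xs ε)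
           (∈ₚ.∈-resp-≈ setoid y≈ε y∈xs))))
           (≡.trans |gs| (cong suc (≡.sym |xs|))) =
    gs₂ ++ gs₁
    , (Unique-resp-↭ q xs! , λ y → mk⇔
        (λ y∈S → ∈-resp-↭ q (Equivalence.to (S⇔xs y) y∈S))
        (λ y∈hs → Equivalence.from (S⇔xs y) (∈-resp-↭ (↭-sym q) y∈hs)))
    -- The path runs from `head` through `ε` to `tail`. Its final vertex `tail`, together with its
    -- visits, gives back all vertices of the closed walk.
    , unique-partialProducts (after ++ʷ before)
        (Unique-resp-↭ (↭-trans visits (rotate vs₁ vs₂)) vs!)
    where
    open Split (split w (∈-resp-↭ (↭-sym p) (here refl)))
    rotate : ∀ ys zs {y} → ys ++ [ y ] ++ zs ↭ y ∷ zs ++ ys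
    rotate ys zs = ↭-trans (↭-shift ys zs) (↭-prep _ (++-comm ys zs))
    q : xs ↭ gs₂ ++ gs₁
    q = drop-∷ (↭-trans (↭-sym p) (↭-trans labels (rotate gs₁ gs₂)))

-- Congruence of integers modulo m

module Modular (m : ℕ) where

  open Data.Integer.Base using (+_)

  infix 4 _≡ₘ_
  -- With the quotient as explicit witness, closure properties reduce to ring identities.
  _≡ₘ_ : ℤ → ℤ → Set
  a ≡ₘ b = ∃[ q ] a ≡ b ℤ.+ q ℤ.* + m

  ≡⇒≡ₘ : ∀ {a b} → a ≡ b → a ≡ₘ b
  ≡⇒≡ₘ {a} ≡.refl = 0ℤ , ≡.sym (ℤₚ.+-identityʳ a)

  -- Otherwise `m` would divide `j ∸ i`, which is positive and smaller than `m`.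
  <⇒≢ₘ : ∀ {i j} → i < j → j < m → ¬ + i ≡ₘ + j
  <⇒≢ₘ {i} {j} i<j j<m (q , e) = >⇒∤ {{>-nonZero (m<n⇒0<n∸m i<j)}}
    (≤-<-trans (m∸n≤m j i) j<m) (divides ℤ.∣ q ∣ (begin
      j ∸ i                            ≡⟨ ℤₚ.∣⊖∣-< i<j ⟨
      ℤ.∣ i ℤ.⊖ j ∣                    ≡⟨ cong ℤ.∣_∣ (ℤₚ.m-n≡m⊖n i j) ⟨
      ℤ.∣ + i ℤ.- + j ∣                ≡⟨ cong (λ a → ℤ.∣ a ℤ.- + j ∣) e ⟩
      ℤ.∣ + j ℤ.+ q ℤ.* + m ℤ.- + j ∣  ≡⟨ cong ℤ.∣_∣ (lemma (+ j) (q ℤ.* + m)) ⟩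
      ℤ.∣ q ℤ.* + m ∣                  ≡⟨ ℤₚ.abs-* q (+ m) ⟩
      ℤ.∣ q ∣ * m                      ∎))
    where
    open ≡.≡-Reasoning
    lemma : ∀ a b → a ℤ.+ b ℤ.- a ≡ b
    lemma = ℤSolver.solve-∀

-- Products of rotations and reflections

module DihedralGroup (m′ : ℕ) where

  -- As `m` is a successor, the exponent `m ∸ 1` in the third relation computes to `m′`.
  m : ℕ
  m = suc m′

  open Defs
  open Data.Integer.Base using (+_)
  open Modular m
  open Groupₚ (Dihedral m) using (inverseʳ-unique)

  open Group (Dihedral m) using (_≈_; setoid; reflexive; ∙-congˡ; ∙-congʳ)
  open SetoidReasoning setoid

  rot ref : ℕ → Expr Generator
  rot i = gen u ^ i
  ref i = rot i ∙ gen v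

  rot-rot : ∀ i j → rot i ∙ rot j ≈ rot (i + j)
  rot-rot zero    j = identityˡ (rot j)
  rot-rot (suc i) j = trans (assoc _ _ _) (∙-congˡ (rot-rot i j))

  rot-ref : ∀ i j → rot i ∙ ref j ≈ ref (i + j)
  rot-ref i j = trans (sym (assoc _ _ _)) (∙-congʳ (rot-rot i j))

  v∙v≈ε : gen v ∙ gen v ≈ ε
  v∙v≈ε = trans (∙-congˡ (sym (identityʳ _))) (relation v²≈e)

  uvu≈v : gen u ∙ gen v ∙ gen u ≈ gen v
  uvu≈v = begin
    gen u ∙ gen v ∙ gen u    ≈⟨ assoc _ _ _ ⟩
    gen u ∙ (gen v ∙ gen u)  ≈⟨ ∙-congˡ (relation vu≈uᵐ⁻¹v) ⟩
    gen u ∙ ref m′           ≈⟨ assoc _ _ _ ⟨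
    ref m                    ≈⟨ ∙-congʳ (relation uᵐ≈e) ⟩
    ε ∙ gen v                ≈⟨ identityˡ _ ⟩
    gen v                    ∎

  ref∙u : ∀ i → ref (suc i) ∙ gen u ≈ ref i
  ref∙u i = begin
    gen u ∙ rot i ∙ gen v ∙ gen u    ≈⟨ ∙-congʳ (∙-congʳ (rot-comm i)) ⟩
    rot i ∙ gen u ∙ gen v ∙ gen u    ≈⟨ ∙-congʳ (assoc _ _ _) ⟩
    rot i ∙ (gen u ∙ gen v) ∙ gen u  ≈⟨ assoc _ _ _ ⟩
    rot i ∙ (gen u ∙ gen v ∙ gen u)  ≈⟨ ∙-congˡ uvu≈v ⟩
    ref i                            ∎
    where
    rot-comm : ∀ i → gen u ∙ rot i ≈ rot i ∙ gen u
    rot-comm zero    = trans (identityʳ _) (sym (identityˡ _))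
    rot-comm (suc i) = trans (∙-congˡ (rot-comm i)) (sym (assoc _ _ _))

  -- Right multiplication by `u` lowers the exponent of a reflection; putting `i + j` on the left
  -- avoids subtraction.
  ref-rot : ∀ i j → ref (i + j) ∙ rot j ≈ ref i
  ref-rot i zero    =
    trans (identityʳ _) (reflexive (cong ref (+-identityʳ i)))
  ref-rot i (suc j) = begin
    ref (i + suc j) ∙ (gen u ∙ rot j)    ≈⟨ assoc _ _ _ ⟨
    ref (i + suc j) ∙ gen u ∙ rot j
      ≡⟨ cong (λ k → ref k ∙ gen u ∙ rot j) (+-suc i j) ⟩
    ref (suc (i + j)) ∙ gen u ∙ rot j    ≈⟨ ∙-congʳ (ref∙u (i + j)) ⟩
    ref (i + j) ∙ rot j                  ≈⟨ ref-rot i j ⟩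
    ref i                                ∎

  ref-ref : ∀ i j → ref (i + j) ∙ ref j ≈ rot i
  ref-ref i j = begin
    ref (i + j) ∙ (rot j ∙ gen v)  ≈⟨ assoc _ _ _ ⟨
    ref (i + j) ∙ rot j ∙ gen v    ≈⟨ ∙-congʳ (ref-rot i j) ⟩
    rot i ∙ gen v ∙ gen v          ≈⟨ assoc _ _ _ ⟩
    rot i ∙ (gen v ∙ gen v)        ≈⟨ ∙-congˡ v∙v≈ε ⟩
    rot i ∙ ε                      ≈⟨ identityʳ _ ⟩
    rot i                          ∎

  rot-m : rot m ≈ ε
  rot-m = relation uᵐ≈e

  rot-m+ : ∀ i → rot (m + i) ≈ rot i
  rot-m+ i = trans (sym (rot-rot m i)) (trans (∙-congʳ rot-m) (identityˡ _))

  ref-m+ : ∀ i → ref (m + i) ≈ ref i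
  ref-m+ i = ∙-congʳ (rot-m+ i)

  rot-*m : ∀ q i → rot (q * m + i) ≈ rot i
  rot-*m zero    i = refl
  rot-*m (suc q) i = begin
    rot (m + q * m + i)    ≡⟨ cong rot (+-assoc m (q * m) i) ⟩
    rot (m + (q * m + i))  ≈⟨ rot-m+ _ ⟩
    rot (q * m + i)        ≈⟨ rot-*m q i ⟩
    rot i                  ∎

  rot-% : ∀ i → rot i ≈ rot (i % m)
  rot-% i = begin
    rot i                      ≡⟨ cong rot (m≡m%n+[m/n]*n i m) ⟩
    rot (i % m + (i / m) * m)  ≡⟨ cong rot (+-comm (i % m) _) ⟩
    rot ((i / m) * m + i % m)  ≈⟨ rot-*m (i / m) (i % m) ⟩
    rot (i % m)                ∎

  -- Normal forms of group elements

  NormalForm : Expr Generator → Set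
  NormalForm x = ∃[ i ] (x ≈ rot i ⊎ x ≈ ref i)

  rot⁻¹ : ∀ i → rot i ⁻¹ ≈ rot (i * m′)
  rot⁻¹ i = sym (inverseʳ-unique (rot i) (rot (i * m′)) (begin
    rot i ∙ rot (i * m′)  ≈⟨ rot-rot i _ ⟩
    rot (i + i * m′)      ≡⟨ cong rot (*-suc i m′) ⟨
    rot (i * m)           ≡⟨ cong rot (+-identityʳ (i * m)) ⟨
    rot (i * m + 0)       ≈⟨ rot-*m i 0 ⟩
    ε                     ∎))

  ref⁻¹ : ∀ i → ref i ⁻¹ ≈ ref i
  ref⁻¹ i = sym (inverseʳ-unique (ref i) (ref i) (ref-ref 0 i))

  -- Adding `j * m` to the exponent makes it at least `j`, so that `ref-rot` and `ref-ref` apply to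
  -- any pair of exponents.
  ref-shift : ∀ i j → ∃[ l ] ref i ≈ ref (l + j)
  ref-shift i j = i + j * m′ , sym (trans (reflexive (cong ref eq)) (∙-congʳ (rot-*m j i)))
    where
    eq : i + j * m′ + j ≡ j * m + i
    eq = ≡.trans (+-assoc i _ j) (≡.trans (+-comm i _)
      (cong (_+ i) (≡.trans (+-comm _ j) (≡.sym (*-suc j m′)))))

  ∙-normalForm : ∀ {x y} → NormalForm x → NormalForm y → NormalForm (x ∙ y)
  ∙-normalForm (i , inj₁ p) (j , inj₁ q) = _ , inj₁ (trans (∙-cong p q) (rot-rot i j))
  ∙-normalForm (i , inj₁ p) (j , inj₂ q) = _ , inj₂ (trans (∙-cong p q) (rot-ref i j))
  ∙-normalForm (i , inj₂ p) (j , inj₁ q) with l , r ← ref-shift i j =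
    l , inj₂ (trans (∙-cong (trans p r) q) (ref-rot l j))
  ∙-normalForm (i , inj₂ p) (j , inj₂ q) with l , r ← ref-shift i j =
    l , inj₁ (trans (∙-cong (trans p r) q) (ref-ref l j))

  normalForm : ∀ x → NormalForm x
  normalForm (gen u) = 1 , inj₁ (sym (identityʳ _))
  normalForm (gen v) = 0 , inj₂ (sym (identityˡ _))
  normalForm ε       = 0 , inj₁ refl
  normalForm (x ∙ y) = ∙-normalForm (normalForm x) (normalForm y)
  normalForm (x ⁻¹)  with normalForm x
  ... | i , inj₁ p = _ , inj₁ (trans (⁻¹-cong p) (rot⁻¹ i))
  ... | i , inj₂ p = _ , inj₂ (trans (⁻¹-cong p) (ref⁻¹ i))

  reducedNormalForm : ∀ x → ∃[ i ] i < m × (x ≈ rot i ⊎ x ≈ ref i)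
  reducedNormalForm x with normalForm x
  ... | i , inj₁ p = i % m , m%n<n i m , inj₁ (trans p (rot-% i))
  ... | i , inj₂ p = i % m , m%n<n i m , inj₂ (trans p (∙-congʳ (rot-% i)))

  -- Invariants separating the normal forms

  -- Evaluation of expressions in the infinite dihedral group ℤ ⋊ {1, -1}.
  translation orientation : Expr Generator → ℤ

  orientation (gen u) = 1ℤ
  orientation (gen v) = -1ℤ
  orientation ε       = 1ℤ
  orientation (x ∙ y) = orientation x ℤ.* orientation y
  orientation (x ⁻¹)  = orientation x

  translation (gen u) = 1ℤ
  translation (gen v) = 0ℤ
  translation ε       = 0ℤ
  translation (x ∙ y) = translation x ℤ.+ orientation x ℤ.* translation y
  translation (x ⁻¹)  = ℤ.- (orientation x ℤ.* translation x)

  -- Orientations are signs, hence their own inverses. This settles both inverse laws for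
  -- `orientation` and the right one for `translation`.
  orientation²≡1 : ∀ x → orientation x ℤ.* orientation x ≡ 1ℤ
  orientation²≡1 (gen u) = ≡.refl
  orientation²≡1 (gen v) = ≡.refl
  orientation²≡1 ε       = ≡.refl
  orientation²≡1 (x ∙ y) = ≡.trans (lemma (orientation x) (orientation y))
    (cong₂ ℤ._*_ (orientation²≡1 x) (orientation²≡1 y))
    where
    lemma : ∀ a b → (a ℤ.* b) ℤ.* (a ℤ.* b) ≡ (a ℤ.* a) ℤ.* (b ℤ.* b)
    lemma = ℤSolver.solve-∀
  orientation²≡1 (x ⁻¹)  = orientation²≡1 x

  orientation-rot : ∀ i → orientation (rot i) ≡ 1ℤ
  orientation-rot zero    = ≡.refl
  orientation-rot (suc i) = ≡.trans (ℤₚ.*-identityˡ _) (orientation-rot i)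

  translation-rot : ∀ i → translation (rot i) ≡ + i
  translation-rot zero    = ≡.refl
  translation-rot (suc i) = cong (λ a → 1ℤ ℤ.+ a) (≡.trans (ℤₚ.*-identityˡ _) (translation-rot i))

  orientation-ref : ∀ i → orientation (ref i) ≡ -1ℤ
  orientation-ref i = cong (ℤ._* -1ℤ) (orientation-rot i)

  translation-ref : ∀ i → translation (ref i) ≡ + i
  translation-ref i = ≡.trans
    (cong₂ ℤ._+_ (translation-rot i) (ℤₚ.*-zeroʳ (orientation (rot i)))) (ℤₚ.+-identityʳ (+ i))

  orientation-cong : ∀ {x y} → x ≈ y → orientation x ≡ orientation y
  orientation-cong (relation uᵐ≈e)     = orientation-rot m
  orientation-cong (relation v²≈e)     = ≡.refl
  orientation-cong (relation vu≈uᵐ⁻¹v) = ≡.sym (orientation-ref m′)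
  orientation-cong refl                = ≡.refl
  orientation-cong (sym p)             = ≡.sym (orientation-cong p)
  orientation-cong (trans p q)         = ≡.trans (orientation-cong p) (orientation-cong q)
  orientation-cong (∙-cong p q)        = cong₂ ℤ._*_ (orientation-cong p) (orientation-cong q)
  orientation-cong (⁻¹-cong p)         = orientation-cong p
  orientation-cong (assoc x y z)       = ℤₚ.*-assoc (orientation x) _ _
  orientation-cong (identityˡ x)       = ℤₚ.*-identityˡ _
  orientation-cong (identityʳ x)       = ℤₚ.*-identityʳ _
  orientation-cong (inverseˡ x)        = orientation²≡1 x
  orientation-cong (inverseʳ x)        = orientation²≡1 x

  -- Only congruence modulo `m` can hold: `u^m` and `ε` have translations `m` and 0, and the two
  -- sides of `vu≈uᵐ⁻¹v` have -1 and `m′`.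
  translation-cong : ∀ {x y} → x ≈ y → translation x ≡ₘ translation y
  translation-cong (relation uᵐ≈e)     =
    1ℤ , ≡.trans (translation-rot m) (lemma (+ m))
    where
    lemma : ∀ a → a ≡ 0ℤ ℤ.+ 1ℤ ℤ.* a
    lemma = ℤSolver.solve-∀
  translation-cong (relation v²≈e)     = ≡⇒≡ₘ ≡.refl
  translation-cong (relation vu≈uᵐ⁻¹v) = -1ℤ ,
    ≡.trans (lemma (+ m′)) (cong (ℤ._+ -1ℤ ℤ.* + m) (≡.sym (translation-ref m′)))
    where
    lemma : ∀ a → -1ℤ ≡ a ℤ.+ -1ℤ ℤ.* (1ℤ ℤ.+ a)
    lemma = ℤSolver.solve-∀
  translation-cong refl                = ≡⇒≡ₘ ≡.refl
  translation-cong (sym {x} {y} p) with q , e ← translation-cong p =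
    ℤ.- q , ≡.trans (lemma (translation y) q (+ m)) (cong (ℤ._+ ℤ.- q ℤ.* + m) (≡.sym e))
    where
    lemma : ∀ b q m → b ≡ b ℤ.+ q ℤ.* m ℤ.+ ℤ.- q ℤ.* m
    lemma = ℤSolver.solve-∀
  translation-cong (trans {z = z} p p′)
    with q , e ← translation-cong p | q′ , e′ ← translation-cong p′ =
    q′ ℤ.+ q , ≡.trans e (≡.trans (cong (ℤ._+ q ℤ.* + m) e′) (lemma (translation z) q q′ (+ m)))
    where
    lemma : ∀ c q q′ m → c ℤ.+ q′ ℤ.* m ℤ.+ q ℤ.* m ≡ c ℤ.+ (q′ ℤ.+ q) ℤ.* m
    lemma = ℤSolver.solve-∀
  translation-cong (∙-cong {x} {x′} {y} {y′} p p′)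
    with q , e ← translation-cong p | q′ , e′ ← translation-cong p′ =
    q ℤ.+ orientation x′ ℤ.* q′ ,
    ≡.trans (cong₂ ℤ._+_ e (cong₂ ℤ._*_ (orientation-cong p) e′))
      (lemma (translation x′) (orientation x′) (translation y′) q q′ (+ m))
    where
    lemma : ∀ a s b q q′ m → a ℤ.+ q ℤ.* m ℤ.+ s ℤ.* (b ℤ.+ q′ ℤ.* m) ≡
                             a ℤ.+ s ℤ.* b ℤ.+ (q ℤ.+ s ℤ.* q′) ℤ.* m
    lemma = ℤSolver.solve-∀
  translation-cong (⁻¹-cong {x} {y} p) with q , e ← translation-cong p =
    ℤ.- (orientation y ℤ.* q) ,
    ≡.trans (cong₂ (λ s a → ℤ.- (s ℤ.* a)) (orientation-cong p) e)
      (lemma (orientation y) (translation y) q (+ m))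
    where
    lemma : ∀ s b q m → ℤ.- (s ℤ.* (b ℤ.+ q ℤ.* m)) ≡ ℤ.- (s ℤ.* b) ℤ.+ ℤ.- (s ℤ.* q) ℤ.* m
    lemma = ℤSolver.solve-∀
  translation-cong (assoc x y z)       = ≡⇒≡ₘ (lemma (translation x) (orientation x)
      (translation y) (orientation y) (translation z))
    where
    lemma : ∀ a s b t c → a ℤ.+ s ℤ.* b ℤ.+ s ℤ.* t ℤ.* c ≡ a ℤ.+ s ℤ.* (b ℤ.+ t ℤ.* c)
    lemma = ℤSolver.solve-∀
  translation-cong (identityˡ x)       = ≡⇒≡ₘ (lemma (translation x))
    where
    lemma : ∀ a → 0ℤ ℤ.+ 1ℤ ℤ.* a ≡ a
    lemma = ℤSolver.solve-∀
  translation-cong (identityʳ x)       = ≡⇒≡ₘ (lemma (translation x) (orientation x))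
    where
    lemma : ∀ a s → a ℤ.+ s ℤ.* 0ℤ ≡ a
    lemma = ℤSolver.solve-∀
  translation-cong (inverseˡ x)        = ≡⇒≡ₘ (ℤₚ.+-inverseˡ (orientation x ℤ.* translation x))
  translation-cong (inverseʳ x)        = ≡⇒≡ₘ (≡.trans
      (lemma (translation x) (orientation x))
      (≡.trans (cong (λ t → translation x ℤ.+ ℤ.- (t ℤ.* translation x)) (orientation²≡1 x))
        (lemma′ (translation x))))
    where
    lemma : ∀ a s → a ℤ.+ s ℤ.* ℤ.- (s ℤ.* a) ≡ a ℤ.+ ℤ.- (s ℤ.* s ℤ.* a)
    lemma = ℤSolver.solve-∀
    lemma′ : ∀ a → a ℤ.+ ℤ.- (1ℤ ℤ.* a) ≡ 0ℤ
    lemma′ = ℤSolver.solve-∀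

  rot≉rot : ∀ {i j} → i < j → j < m → ¬ rot i ≈ rot j
  rot≉rot {i} {j} i<j j<m p = <⇒≢ₘ i<j j<m
    (≡.subst₂ _≡ₘ_ (translation-rot i) (translation-rot j) (translation-cong p))

  ref≉ref : ∀ {i j} → i < j → j < m → ¬ ref i ≈ ref j
  ref≉ref {i} {j} i<j j<m p = <⇒≢ₘ i<j j<m
    (≡.subst₂ _≡ₘ_ (translation-ref i) (translation-ref j) (translation-cong p))

  rot≉ref : ∀ i j → ¬ rot i ≈ ref j
  rot≉ref i j p with () ← ≡.trans (≡.sym (orientation-rot i))
    (≡.trans (orientation-cong p) (orientation-ref j))

-- Locates an index among consecutive blocks; the coverage proofs below use it to find the segment
-- of the walk responsible for an exponent.
<-+-split : ∀ a {b i} → i < a + b → i < a ⊎ ∃[ j ] j < b × i ≡ a + j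
<-+-split zero            i<b       = inj₂ (_ , i<b , ≡.refl)
<-+-split (suc a) {i = zero}  _         = inj₁ z<s
<-+-split (suc a) {i = suc i} (s<s i<a+b) with <-+-split a i<a+b
... | inj₁ i<a             = inj₁ (s<s i<a)
... | inj₂ (j , j<b , eq) = inj₂ (j , j<b , cong suc eq)

-- Zigzag and nested walks

module DihedralWalks (m′ : ℕ) where

  open DihedralGroup m′
  open Group (Dihedral m)
  open ListMembership setoid using (_∈_)
  open Walks (Dihedral m) public
  open Groupₚ (Dihedral m) using (//-rightDividesʳ)

  rot-rot⁻¹ : ∀ i j → rot (i + j) ∙ rot j ⁻¹ ≈ rot i
  rot-rot⁻¹ i j = trans (∙-congʳ (sym (rot-rot i j))) (//-rightDividesʳ (rot j) (rot i))

  ref-rot⁻¹ : ∀ i j → ref i ∙ rot j ⁻¹ ≈ ref (i + j)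
  ref-rot⁻¹ i j = trans (∙-congʳ (sym (ref-rot i j))) (//-rightDividesʳ (rot j) (ref (i + j)))

  -- u^(n + x) → u^(n + x + l) v → u^(n + x - 1) → … → u^x. A reflection u^l v
  -- leads both from u^i to u^(i + l) v and from u^(i + l) v to u^i, so the exponents of
  -- the labels increase by one at every step.
  zigLabels : ℕ → ℕ → List (Expr Generator)
  zigLabels l zero    = []
  zigLabels l (suc n) = ref l ∷ ref (suc l) ∷ zigLabels (2 + l) n

  zigVisits : ℕ → ℕ → ℕ → List (Expr Generator)
  zigVisits x l zero    = []
  zigVisits x l (suc n) = rot (suc n + x) ∷ ref (suc n + x + l) ∷ zigVisits x (2 + l) n

  zig : ∀ x l n → Walk (rot (n + x)) (zigLabels l n) (zigVisits x l n) (rot x)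
  zig x l zero    = stay refl
  zig x l (suc n) =
    step refl (rot-ref (suc n + x) l)
      (step refl (trans (∙-congʳ (reflexive (cong ref (≡.sym (+-suc (n + x) l)))))
          (ref-ref (n + x) (suc l)))
        (zig x (2 + l) n))

  length-zigLabels : ∀ l n → length (zigLabels l n) ≡ n * 2
  length-zigLabels l zero    = ≡.refl
  length-zigLabels l (suc n) = cong (2 +_) (length-zigLabels (2 + l) n)

  ref∈zigLabels : ∀ l n {i} → i < n * 2 → ref (l + i) ∈ zigLabels l n
  ref∈zigLabels l (suc n) {zero}        _               =
    here (reflexive (cong ref (+-identityʳ l)))
  ref∈zigLabels l (suc n) {suc zero}    _               =
    there (here (reflexive (cong ref (+-comm l 1))))
  ref∈zigLabels l (suc n) {suc (suc i)} (s<s (s<s i<n)) =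
    there (there (∈ₚ.∈-resp-≈ setoid (reflexive (cong ref (eq l i))) (ref∈zigLabels (2 + l) n i<n)))
    where
    eq : ∀ l i → 2 + l + i ≡ l + (2 + i)
    eq = solve-∀

  rot∈zigVisits : ∀ x l n {i} → i < n → rot (x + suc i) ∈ zigVisits x l n
  rot∈zigVisits x l (suc n) i<1+n with m<1+n⇒m<n∨m≡n i<1+n
  ... | inj₁ i<n    = there (there (rot∈zigVisits x (2 + l) n i<n))
  ... | inj₂ ≡.refl = here (reflexive (cong rot (+-comm x (suc n))))

  -- Each round lowers the rotation by one and raises the label by two, so the exponents of the
  -- visited reflections increase by one.
  ref∈zigVisits : ∀ x l n {i} → i < n → ref (n + x + l + i) ∈ zigVisits x l n
  ref∈zigVisits x l (suc n) {zero}  _         =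
    there (here (reflexive (cong ref (+-identityʳ _))))
  ref∈zigVisits x l (suc n) {suc i} (s<s i<n) =
    there (there (∈ₚ.∈-resp-≈ setoid (reflexive (cong ref (eq x l n i)))
      (ref∈zigVisits x (2 + l) n i<n)))
    where
    eq : ∀ x l n i → n + x + (2 + l) + i ≡ suc n + x + l + suc i
    eq = solve-∀

  -- Reflections u^j v with j running through a + δ, a + δ + n, a + δ + 1, a + δ + n - 1, …
  -- towards the middle of the interval, then one step to the rotations and
  -- the analogous path from the middle of [a, a + n] outwards. Right multiplication
  -- by a rotation shifts the exponents of reflections and rotations in opposite
  -- directions, so the two halves use each of u^±1, …, u^±n once.
  nestLabels : ℕ → ℕ → List (Expr Generator)
  nestLabels δ 0             = [ ref δ ]
  nestLabels δ 1             = rot 1 ⁻¹ ∷ ref (suc δ) ∷ [ rot 1 ]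
  nestLabels δ (suc (suc n)) = rot (2 + n) ⁻¹ ∷ rot (1 + n) ∷
    nestLabels δ n ++ rot (1 + n) ⁻¹ ∷ [ rot (2 + n) ]

  nestVisits : ℕ → ℕ → ℕ → List (Expr Generator)
  nestVisits δ 0             a = [ ref (a + δ) ]
  nestVisits δ 1             a = ref (a + δ) ∷ ref (a + δ + 1) ∷ [ rot a ]
  nestVisits δ (suc (suc n)) a = ref (a + δ) ∷ ref (a + δ + (2 + n)) ∷
    nestVisits δ n (suc a) ++ rot (suc a + n) ∷ [ rot a ]

  nest : ∀ δ n a → Walk (ref (a + δ)) (nestLabels δ n) (nestVisits δ n a) (rot (a + n))
  nest δ 0             a =
    edge (ref δ) (trans (ref-ref a δ) (reflexive (cong rot (≡.sym (+-identityʳ a)))))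
  nest δ 1             a =
    step refl (ref-rot⁻¹ (a + δ) 1)
      (step refl (trans (∙-congʳ (reflexive (cong ref (eq a δ)))) (ref-ref a (suc δ)))
        (edge (rot 1) (rot-rot a 1)))
    where
    eq : ∀ a δ → a + δ + 1 ≡ a + suc δ
    eq = solve-∀
  nest δ (suc (suc n)) a =
    -- The exponent goes up by `2 + n` and down by `1 + n`, a net shift by one to the start of the
    -- inner walk for `suc a`.
    step refl (ref-rot⁻¹ (a + δ) (2 + n))
      (step refl (trans (∙-congʳ (reflexive (cong ref (+-suc (a + δ) (suc n)))))
          (ref-rot (suc a + δ) (suc n)))
        (nest δ n (suc a) ++ʷ
          step refl (trans (∙-congʳ (reflexive (cong rot (≡.sym (+-suc a n)))))
              (rot-rot⁻¹ a (1 + n)))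
            (edge (rot (2 + n)) (rot-rot a (2 + n)))))

  length-nestLabels : ∀ δ n → length (nestLabels δ n) ≡ suc (n * 2)
  length-nestLabels δ 0             = ≡.refl
  length-nestLabels δ 1             = ≡.refl
  length-nestLabels δ (suc (suc n)) = cong (2 +_) (≡.trans (length-++ (nestLabels δ n))
    (≡.trans (cong (_+ 2) (length-nestLabels δ n)) (+-comm (suc (n * 2)) 2)))

  -- The outer layer for `2 + n` supplies the exponents ±(2 + n) and ±(1 + n), one sign before the
  -- inner walk and the other after it.
  rot±∈nestLabels : ∀ δ n {i} → i < n →
    rot (suc i) ∈ nestLabels δ n × rot (suc i) ⁻¹ ∈ nestLabels δ n
  rot±∈nestLabels δ 1             z<s   = there (there (here refl)) , here refl
  rot±∈nestLabels δ (suc (suc n)) i<2+n with m<1+n⇒m<n∨m≡n i<2+n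
  ... | inj₂ ≡.refl =
    there (there (∈ₚ.∈-++⁺ʳ setoid (nestLabels δ n) (there (here refl)))) , here refl
  ... | inj₁ i<1+n with m<1+n⇒m<n∨m≡n i<1+n
  ...   | inj₂ ≡.refl =
    there (here refl) , there (there (∈ₚ.∈-++⁺ʳ setoid (nestLabels δ n) (here refl)))
  ...   | inj₁ i<n with p , q ← rot±∈nestLabels δ n i<n =
    there (there (∈ₚ.∈-++⁺ˡ setoid p)) , there (there (∈ₚ.∈-++⁺ˡ setoid q))

  -- The label of the step from the reflections to the rotations.
  ref∈nestLabels : ∀ d n → ref (d + ⌈ n /2⌉ * 2) ∈ nestLabels (d + n) n
  ref∈nestLabels d 0             = here refl
  ref∈nestLabels d 1             = there (here (reflexive (cong ref (eq d))))
    where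
    eq : ∀ d → d + 2 ≡ suc (d + 1)
    eq = solve-∀
  ref∈nestLabels d (suc (suc n)) = there (there (∈ₚ.∈-++⁺ˡ setoid
    (≡.subst₂ (λ c δ → ref c ∈ nestLabels δ n) (eq d (⌈ n /2⌉ * 2)) (eq d n)
      (ref∈nestLabels (2 + d) n))))
    where
    eq : ∀ d i → 2 + d + i ≡ d + (2 + i)
    eq = solve-∀

  -- Each layer visits the two ends of the current interval of exponents and leaves its interior to
  -- the inner walk.
  ref∈nestVisits : ∀ δ n a {i} → i < suc n → ref (a + δ + i) ∈ nestVisits δ n a
  ref∈nestVisits δ 0             a {zero}     _     = here (reflexive (cong ref (+-identityʳ _)))
  ref∈nestVisits δ 0             a {suc i}    (s≤s ())
  ref∈nestVisits δ 1             a {zero}     _     = here (reflexive (cong ref (+-identityʳ _)))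
  ref∈nestVisits δ 1             a {suc zero} _     = there (here refl)
  ref∈nestVisits δ 1             a {suc (suc i)} (s≤s (s≤s ()))
  ref∈nestVisits δ (suc (suc n)) a {zero}     _     = here (reflexive (cong ref (+-identityʳ _)))
  ref∈nestVisits δ (suc (suc n)) a {suc i} (s<s i<2+n) with m<1+n⇒m<n∨m≡n i<2+n
  ... | inj₁ i<1+n  = there (there (∈ₚ.∈-++⁺ˡ setoid (∈ₚ.∈-resp-≈ setoid
    (reflexive (cong ref (≡.sym (+-suc (a + δ) i)))) (ref∈nestVisits δ n (suc a) i<1+n))))
  ... | inj₂ ≡.refl = there (here refl)

  -- The bound is `n`, not `suc n`: the rotation u^(a + n) is the end of the walk and thus not among
  -- its visits.
  rot∈nestVisits : ∀ δ n a {i} → i < n → rot (a + i) ∈ nestVisits δ n a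
  rot∈nestVisits δ 1             a z<s =
    there (there (here (reflexive (cong rot (+-identityʳ a)))))
  rot∈nestVisits δ (suc (suc n)) a {zero} _ =
    there (there (∈ₚ.∈-++⁺ʳ setoid (nestVisits δ n (suc a))
      (there (here (reflexive (cong rot (+-identityʳ a)))))))
  rot∈nestVisits δ (suc (suc n)) a {suc i} (s<s i<1+n) with m<1+n⇒m<n∨m≡n i<1+n
  ... | inj₁ i<n    = there (there (∈ₚ.∈-++⁺ˡ setoid (∈ₚ.∈-resp-≈ setoid
    (reflexive (cong rot (≡.sym (+-suc a i)))) (rot∈nestVisits δ n (suc a) i<n))))
  ... | inj₂ ≡.refl = there (there (∈ₚ.∈-++⁺ʳ setoid (nestVisits δ n (suc a))
    (here (reflexive (cong rot (+-suc a n))))))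

-- The closed walk

module DihedralCycle (s t : ℕ) where

  n : ℕ
  n = s + t

  open DihedralGroup (suc (n * 2))
  open DihedralWalks (suc (n * 2))
  open Group (Dihedral m)
  open ListMembership setoid using (_∈_)
  open UniqueSetoid setoid using (Unique)
  open Groupₚ (Dihedral m) using (inverseˡ-unique)

  -- The zigzags carry the reflections with exponents 0, ..., 2t - 1 and 2t + 1, ..., 2n, the next
  -- step 2n + 1. The nested walk supplies u^±1, ..., u^±n and one reflection; the last step is the
  -- involution u^(m/2).
  labels visits : List (Expr Generator)
  labels = zigLabels 0 t ++ zigLabels (suc (t * 2)) s ++ ref (suc (n * 2)) ∷
           nestLabels n n ++ [ rot (suc n) ]
  visits = zigVisits (s + (2 + n)) 0 t ++ zigVisits (2 + n) (suc (t * 2)) s ++ rot (2 + n) ∷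
           nestVisits n n 1 ++ [ rot (suc n) ]

  cycle : Walk ε labels visits ε
  -- Starting at `ε` in the form u^m lets the zigzags descend through natural exponents, from `m` to
  -- `2 + n`, which stands for u^-n.
  cycle = walk-respˡ ε≈rot (zig (s + (2 + n)) 0 t ++ʷ zig (2 + n) (suc (t * 2)) s ++ʷ
    step refl ref-edge (nest n n 1 ++ʷ edge (rot (suc n)) rot-edge))
    where
    eq₁ : ∀ s t → 2 + (s + t) * 2 ≡ t + (s + (2 + (s + t)))
    eq₁ = solve-∀
    ε≈rot : ε ≈ rot (t + (s + (2 + n)))
    ε≈rot = trans (sym rot-m) (reflexive (cong rot (eq₁ s t)))
    eq₂ : ∀ n → 2 + n + suc (n * 2) ≡ 2 + n * 2 + suc n
    eq₂ = solve-∀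
    ref-edge : rot (2 + n) ∙ ref (suc (n * 2)) ≈ ref (suc n)
    ref-edge = trans (rot-ref (2 + n) (suc (n * 2)))
      (trans (reflexive (cong ref (eq₂ n))) (ref-m+ (suc n)))
    eq₃ : ∀ n → suc n + suc n ≡ 2 + n * 2
    eq₃ = solve-∀
    rot-edge : rot (suc n) ∙ rot (suc n) ≈ ε
    rot-edge = trans (rot-rot (suc n) (suc n)) (trans (reflexive (cong rot (eq₃ n))) rot-m)

  length-labels : length labels ≡ suc (2 * m ∸ 2)
  length-labels = begin
    length labels
      ≡⟨ length-++ (zigLabels 0 t) ⟩
    length (zigLabels 0 t) + _
      ≡⟨ cong₂ _+_ (length-zigLabels 0 t) (≡.trans (length-++ (zigLabels (suc (t * 2)) s))
          (cong₂ _+_ (length-zigLabels (suc (t * 2)) s) (cong suc (≡.trans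
            (length-++ (nestLabels n n)) (cong (_+ 1) (length-nestLabels n n)))))) ⟩
    t * 2 + (s * 2 + suc (suc (n * 2) + 1))
      ≡⟨ eq s t ⟩
    suc (n * 2 + (2 + (n * 2 + 0)))
      ∎
    where
    open ≡.≡-Reasoning
    eq : ∀ s t → t * 2 + (s * 2 + suc (suc ((s + t) * 2) + 1)) ≡
                 suc ((s + t) * 2 + (2 + ((s + t) * 2 + 0)))
    eq = solve-∀

  -- Every nontrivial element is a label

  zig₁ˡ : ∀ {x} → x ∈ zigLabels 0 t → x ∈ labels
  zig₁ˡ = ∈ₚ.∈-++⁺ˡ setoid

  zig₂ˡ : ∀ {x} → x ∈ zigLabels (suc (t * 2)) s → x ∈ labels
  zig₂ˡ p = ∈ₚ.∈-++⁺ʳ setoid (zigLabels 0 t) (∈ₚ.∈-++⁺ˡ setoid p)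

  restˡ : ∀ {x} → x ∈ ref (suc (n * 2)) ∷ nestLabels n n ++ [ rot (suc n) ] → x ∈ labels
  restˡ p = ∈ₚ.∈-++⁺ʳ setoid (zigLabels 0 t) (∈ₚ.∈-++⁺ʳ setoid (zigLabels (suc (t * 2)) s) p)

  nestˡ : ∀ {x} → x ∈ nestLabels n n → x ∈ labels
  nestˡ p = restˡ (there (∈ₚ.∈-++⁺ˡ setoid p))

  rot∈labels : ∀ {i} → suc i < m → rot (suc i) ∈ labels
  rot∈labels {i} 1+i<m with <-+-split n (≡.subst (i <_) (eq n) (s<s⁻¹ 1+i<m))
    where
    eq : ∀ n → suc (n * 2) ≡ n + suc n
    eq = solve-∀
  ... | inj₁ i<n = nestˡ (proj₁ (rot±∈nestLabels n n i<n))
  ... | inj₂ (zero , _ , ≡.refl) = restˡ (there (∈ₚ.∈-++⁺ʳ setoid (nestLabels n n)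
    (here (reflexive (cong (λ k → rot (suc k)) (+-identityʳ n))))))
  -- Exponents above `n + 1` occur as inverses: `suc p` is the complement of the exponent to `m`.
  ... | inj₂ (suc j , s<s j<n , ≡.refl) =
    ∈ₚ.∈-resp-≈ setoid (sym rot≈) (nestˡ (proj₂ (rot±∈nestLabels n n p<n)))
    where
    p : ℕ
    p = n ∸ suc j
    p<n : p < n
    p<n = ∸-monoʳ-< z<s j<n
    eq : ∀ n j p → suc (n + suc j) + suc p ≡ 2 + n + (p + suc j)
    eq = solve-∀
    eq′ : ∀ n → 2 + n + n ≡ 2 + n * 2
    eq′ = solve-∀
    rot≈ : rot (suc (n + suc j)) ≈ rot (suc p) ⁻¹
    rot≈ = inverseˡ-unique _ _ (trans (rot-rot _ _) (trans (reflexive (cong rot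
      (≡.trans (eq n j p) (≡.trans (cong (2 + n +_) (m∸n+n≡m j<n)) (eq′ n))))) rot-m))

  ref∈labels : ⌈ n /2⌉ ≡ t → ∀ {i} → i < m → ref i ∈ labels
  ref∈labels ⌈n/2⌉≡t {i} i<m with <-+-split (t * 2) (≡.subst (i <_) (eq s t) i<m)
    where
    eq : ∀ s t → 2 + (s + t) * 2 ≡ t * 2 + suc (s * 2 + 1)
    eq = solve-∀
  ... | inj₁ i<2t = zig₁ˡ (ref∈zigLabels 0 t i<2t)
  -- The exponent 2t skipped between the zigzags is that of the one reflection in the nested walk,
  -- by the choice of `t` as `⌈ n /2⌉`.
  ... | inj₂ (zero , _ , ≡.refl) = nestˡ (≡.subst (λ c → ref c ∈ nestLabels n n)
    (≡.trans (cong (_* 2) ⌈n/2⌉≡t) (≡.sym (+-identityʳ (t * 2)))) (ref∈nestLabels 0 n))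
  ... | inj₂ (suc j , s<s j< , ≡.refl) with <-+-split (s * 2) j<
  ...   | inj₁ j<2s = zig₂ˡ (≡.subst (λ c → ref c ∈ zigLabels (suc (t * 2)) s)
    (≡.sym (+-suc (t * 2) j)) (ref∈zigLabels (suc (t * 2)) s j<2s))
  ...   | inj₂ (zero , _ , ≡.refl) = restˡ (here (reflexive (cong ref (eq s t))))
    where
    eq : ∀ s t → t * 2 + suc (s * 2 + 0) ≡ suc ((s + t) * 2)
    eq = solve-∀
  ...   | inj₂ (suc _ , s≤s () , _)

  nontrivial∈labels : ⌈ n /2⌉ ≡ t → ∀ x → ¬ x ≈ ε → x ∈ labels
  nontrivial∈labels ⌈n/2⌉≡t x x≉ε with reducedNormalForm x
  ... | zero  , _     , inj₁ x≈ = contradiction x≈ x≉ε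
  ... | suc i , 1+i<m , inj₁ x≈ = ∈ₚ.∈-resp-≈ setoid (sym x≈) (rot∈labels 1+i<m)
  ... | i     , i<m   , inj₂ x≈ = ∈ₚ.∈-resp-≈ setoid (sym x≈) (ref∈labels ⌈n/2⌉≡t i<m)

  -- The vertices of the walk are distinct

  zig₁ᵛ : ∀ {x} → x ∈ zigVisits (s + (2 + n)) 0 t → x ∈ visits
  zig₁ᵛ = ∈ₚ.∈-++⁺ˡ setoid

  zig₂ᵛ : ∀ {x} → x ∈ zigVisits (2 + n) (suc (t * 2)) s → x ∈ visits
  zig₂ᵛ p = ∈ₚ.∈-++⁺ʳ setoid (zigVisits (s + (2 + n)) 0 t) (∈ₚ.∈-++⁺ˡ setoid p)

  restᵛ : ∀ {x} → x ∈ rot (2 + n) ∷ nestVisits n n 1 ++ [ rot (suc n) ] → x ∈ visits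
  restᵛ p = ∈ₚ.∈-++⁺ʳ setoid (zigVisits (s + (2 + n)) 0 t)
    (∈ₚ.∈-++⁺ʳ setoid (zigVisits (2 + n) (suc (t * 2)) s) p)

  nestᵛ : ∀ {x} → x ∈ nestVisits n n 1 → x ∈ visits
  nestᵛ p = restᵛ (there (∈ₚ.∈-++⁺ˡ setoid p))

  -- Exponents 1, ..., m match the walk, which meets the identity as u^m: first the nested walk,
  -- then u^(n + 1) and u^(n + 2), then the second and the first zigzag.
  rot-suc∈visits : ∀ {i} → i < m → rot (suc i) ∈ visits
  rot-suc∈visits {i} i<m with <-+-split n (≡.subst (i <_) (eq s t) i<m)
    where
    eq : ∀ s t → 2 + (s + t) * 2 ≡ s + t + suc (suc (s + t))
    eq = solve-∀
  ... | inj₁ i<n = nestᵛ (rot∈nestVisits n n 1 i<n)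
  ... | inj₂ (zero , _ , ≡.refl) = restᵛ (there (∈ₚ.∈-++⁺ʳ setoid (nestVisits n n 1)
    (here (reflexive (cong (λ k → rot (suc k)) (+-identityʳ n))))))
  ... | inj₂ (suc zero , _ , ≡.refl) =
    restᵛ (here (reflexive (cong (λ k → rot (suc k)) (+-comm n 1))))
  ... | inj₂ (suc (suc j) , s<s (s<s j<n) , ≡.refl) with <-+-split s j<n
  ...   | inj₁ j<s = zig₂ᵛ (≡.subst (λ c → rot c ∈ zigVisits (2 + n) (suc (t * 2)) s)
    (eq n j) (rot∈zigVisits (2 + n) (suc (t * 2)) s j<s))
    where
    eq : ∀ n j → 2 + n + suc j ≡ suc (n + suc (suc j))
    eq = solve-∀
  ...   | inj₂ (k , k<t , ≡.refl) = zig₁ᵛ (≡.subst (λ c → rot c ∈ zigVisits (s + (2 + n)) 0 t)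
    (eq s n k) (rot∈zigVisits (s + (2 + n)) 0 t k<t))
    where
    eq : ∀ s n k → s + (2 + n) + suc k ≡ suc (n + suc (suc (s + k)))
    eq = solve-∀

  rot∈visits : ∀ {i} → i < m → rot i ∈ visits
  rot∈visits {suc i} 1+i<m = rot-suc∈visits (<⇒≤ 1+i<m)
  rot∈visits {zero}  _     = ∈ₚ.∈-resp-≈ setoid
    rot-m (rot-suc∈visits (n<1+n _))

  -- The cycle misses u^t v, and no other element.
  ref∈visits : ∀ {i} → i < m → ref i ∈ ref t ∷ visits
  ref∈visits {i} i<m with <-+-split t (≡.subst (i <_) (eq s t) i<m)
    where
    eq : ∀ s t → 2 + (s + t) * 2 ≡ t + suc (s + suc (s + t))
    eq = solve-∀
  ... | inj₁ i<t = there (zig₁ᵛ (∈ₚ.∈-resp-≈ setoid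
    (trans (reflexive (cong ref (eq s t i))) (ref-m+ i)) (ref∈zigVisits (s + (2 + n)) 0 t i<t)))
    where
    eq : ∀ s t i → t + (s + (2 + (s + t))) + 0 + i ≡ 2 + (s + t) * 2 + i
    eq = solve-∀
  ... | inj₂ (zero , _ , ≡.refl) = here (reflexive (cong ref (+-identityʳ t)))
  ... | inj₂ (suc j , s<s j< , ≡.refl) with <-+-split s j<
  ...   | inj₁ j<s = there (zig₂ᵛ (∈ₚ.∈-resp-≈ setoid
    (trans (reflexive (cong ref (eq s t j))) (ref-m+ (t + suc j)))
    (ref∈zigVisits (2 + n) (suc (t * 2)) s j<s)))
    where
    eq : ∀ s t j → s + (2 + (s + t)) + suc (t * 2) + j ≡ 2 + (s + t) * 2 + (t + suc j)
    eq = solve-∀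
  ...   | inj₂ (k , k<1+n , ≡.refl) = there (nestᵛ (≡.subst (λ c → ref c ∈ nestVisits n n 1)
    (eq s t k) (ref∈nestVisits n n 1 k<1+n)))
    where
    eq : ∀ s t k → suc (s + t + k) ≡ t + suc (s + k)
    eq = solve-∀

  -- By counting: `ref t ∷ visits` has 2m entries and contains the 2m distinct normal forms, so it
  -- is a permutation of their list.
  visits! : Unique visits
  visits! = UniqueSetoid.tail setoid (Permutationₚ.Unique-resp-↭ setoid
    (Permutation.↭-sym setoid (unique-⊆⇒↭ elements! elements⊆ length≡)) elements!)
    where
    open Pigeonhole setoid
    elements : List (Expr Generator)
    elements = applyUpTo rot m ++ applyUpTo ref m
    elements! : Unique elements
    elements! = Uniqueₚ.++⁺ setoid (Uniqueₚ.applyUpTo⁺₁ setoid rot m rot≉rot)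
      (Uniqueₚ.applyUpTo⁺₁ setoid ref m ref≉ref) disjoint
      where
      disjoint : ∀ {x} → ¬ (x ∈ applyUpTo rot m × x ∈ applyUpTo ref m)
      disjoint (p , q)
        with i , _ , x≈ ← ∈ₚ.∈-applyUpTo⁻ setoid rot p
           | j , _ , x≈′ ← ∈ₚ.∈-applyUpTo⁻ setoid ref q = rot≉ref i j (trans (sym x≈) x≈′)
    elements⊆ : ∀ {x} → x ∈ elements → x ∈ ref t ∷ visits
    elements⊆ x∈ with ∈ₚ.∈-++⁻ setoid (applyUpTo rot m) x∈
    ... | inj₁ p with i , i<m , x≈ ← ∈ₚ.∈-applyUpTo⁻ setoid rot p =
      ∈ₚ.∈-resp-≈ setoid (sym x≈) (there (rot∈visits i<m))
    ... | inj₂ p with i , i<m , x≈ ← ∈ₚ.∈-applyUpTo⁻ setoid ref p =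
      ∈ₚ.∈-resp-≈ setoid (sym x≈) (ref∈visits i<m)
    length≡ : suc (length visits) ≡ length elements
    length≡ = ≡.trans (cong suc (≡.trans (length-visits cycle) length-labels))
      (≡.trans (eq n) (≡.sym (≡.trans (length-++ (applyUpTo rot m))
        (cong₂ _+_ (length-applyUpTo rot m) (length-applyUpTo ref m)))))
      where
      eq : ∀ n → 2 + (n * 2 + (2 + (n * 2 + 0))) ≡ 2 + n * 2 + (2 + n * 2)
      eq = solve-∀

  sequencing : ⌈ n /2⌉ ≡ t → {ℓ : Level} (S : Pred (Expr Generator) ℓ) → ε ∉ S →
    HasCardinality (Dihedral m) S (2 * m ∸ 2) → HasSequencing (Dihedral m) S
  sequencing ⌈n/2⌉≡t =
    closedWalk⇒sequencing cycle visits! length-labels (nontrivial∈labels ⌈n/2⌉≡t)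

theorem4p3 : {s : Level} (m : ℕ) .{{_ : NonZero m}} → 2 ∣ m →
    (S : Pred (Group.Carrier (Dihedral m)) s) →
    Group.ε (Dihedral m) ∉ S →
    HasCardinality (Dihedral m) S (2 * m ∸ 2) →
    HasSequencing (Dihedral m) S
-- The quotient is a successor as `m` is nonzero. The cycle is built for `⌊ n /2⌋ + ⌈ n /2⌉` in
-- place of `n`; the same equation transports the result and shows that `⌈ n /2⌉` is the required
-- `t`.
theorem4p3 {s} _ (divides (suc n) ≡.refl) = ≡.subst Statement (⌊n/2⌋+⌈n/2⌉≡n n)
  (sequencing (cong ⌈_/2⌉ (⌊n/2⌋+⌈n/2⌉≡n n)))
  where
  open DihedralCycle ⌊ n /2⌋ ⌈ n /2⌉ using (sequencing)
  Statement : ℕ → Set _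
  Statement k = (S : Pred (Expr Generator) s) → Group.ε G ∉ S →
    HasCardinality G S (2 * (suc k * 2) ∸ 2) → HasSequencing G S
    where G = Dihedral (suc k * 2)
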